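{- Let $p\ge 7$ be a prime and $k$ an integer with $(p+1)/2\le k\le p-3$. Then $\mathsf{BO}(k,\mathbb{Z}/p\mathbb{Z})=k+1$.
   Context: For a positive integer $k$, a set $\{g_1,\dots,g_k\}$ of $k$ distinct elements of a finite abelian group $G$ (written additively) is called $k$-barycentric if $\sum_{i=1}^k g_i = k\,g_j$ for some $1\le j\le k$. The $k$-th barycentric Olson constant $\mathsf{BO}(k,G)$ is the smallest integer $\ell$ such that every subset $A\subseteq G$ with $|A|\ge \ell$ contains a $k$-barycentric subset (so that always $\mathsf{BO}(k,G)\le |G|+1$). -}

module Defs where

open import Algebra.Bundles using (AbelianGroup)
open import Algebra.Definitions.RawMonoid using (sum; _×_)
open import Data.Fin.Base using (Fin; toℕ; fromℕ<)
open import Data.Fin.Properties using (toℕ-fromℕ<; toℕ-injective; toℕ<n)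
open import Data.Fin.Subset using (Subset; _∈_; ∣_∣)
open import Data.Integer.Base as ℤ using (ℤ; +_; -_; 0ℤ; _%ℕ_; _/ℕ_)
open import Data.Integer.DivMod using (n%ℕd<d; a≡a%ℕn+[a/ℕn]*n)
open import Data.Integer.Divisibility.Signed
  using (_∣_; divides; ∣m∣n⇒∣m+n; ∣m⇒∣-m; ∣⇒∣ᵤ)
import Data.Integer.Properties as ℤ
open import Data.Integer.Solver using (module +-*-Solver)
open import Data.Nat.Base as ℕ using (ℕ; zero; suc; NonZero; _≤_; _<_; _∸_)
import Data.Nat.Divisibility as ℕ
import Data.Nat.Properties as ℕ
open import Data.Product.Base using (Σ-syntax; ∃-syntax; _,_) renaming (_×_ to _∧_)
open import Data.Sum.Base using (inj₁; inj₂)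
open import Data.Vec.Functional using (Vector)
open import Function.Bundles using (Inverse)
open import Function.Definitions using (Injective)
open import Level using (Level; _⊔_) renaming (suc to lsuc; zero to 0ℓ)
open import Relation.Binary.PropositionalEquality
  using (_≡_; refl; sym; trans; cong; subst; setoid)
open import Relation.Nullary.Negation using (contradiction)

private
  variable
    c ℓ : Level

-- The enumeration lets subsets of the group be given as subsets of Fin order.
record FiniteAbelianGroup c ℓ : Set (lsuc (c ⊔ ℓ)) where
  field
    abelianGroup : AbelianGroup c ℓ
    order        : ℕ
    enumeration  : Inverse (AbelianGroup.setoid abelianGroup) (setoid (Fin order))

  open AbelianGroup abelianGroup public
  open Inverse enumeration public using () renaming (to to index; from to element)

module _ (G : FiniteAbelianGroup c ℓ) where
  open FiniteAbelianGroup G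

  -- A k-element set {g₁,…,gₖ} is presented by an injective listing of its
  -- elements; the condition does not depend on the order of the listing.
  IsBarycentric : (k : ℕ) → Vector Carrier k → Set ℓ
  IsBarycentric k g = ∃[ j ] sum rawMonoid g ≈ _×_ rawMonoid k (g j)

  ContainsBarycentric : ℕ → Subset order → Set (c ⊔ ℓ)
  ContainsBarycentric k A =
    Σ[ g ∈ Vector Carrier k ]
      Injective _≡_ _≈_ g ∧ (∀ i → index (g i) ∈ A) ∧ IsBarycentric k g

  ForcesBarycentric : ℕ → ℕ → Set (c ⊔ ℓ)
  ForcesBarycentric k l =
    ∀ (A : Subset order) → l ≤ ∣ A ∣ → ContainsBarycentric k A

-- BO(k,G) = l, for k ≥ 1.  Restricting "smallest integer" to ℕ loses nothing:
-- every negative integer bounds the same sets from below as 0, and 0 itself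
-- fails because of the empty set.
infix 4 BO[_,_]≡_

BO[_,_]≡_ : ℕ → FiniteAbelianGroup c ℓ → ℕ → Set (c ⊔ ℓ)
BO[ k , G ]≡ l = ForcesBarycentric G k l ∧ (∀ m → ForcesBarycentric G k m → l ≤ m)

infix 4 _≡_[mod_]

-- A record rather than a synonym, so that i and j can be inferred.
record _≡_[mod_] (i j : ℤ) (n : ℕ) : Set where
  constructor mod
  field
    n∣i-j : + n ∣ i ℤ.- j

module _ {n : ℕ} where
  open +-*-Solver

  mod-reflexive : ∀ {i j} → i ≡ j → i ≡ j [mod n ]
  mod-reflexive {i} refl = mod (divides 0ℤ (ℤ.+-inverseʳ i))

  mod-sym : ∀ {i j} → i ≡ j [mod n ] → j ≡ i [mod n ]
  mod-sym {i} {j} (mod d) = mod (subst (+ n ∣_)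
    (solve 2 (λ x y → :- (x :- y) := y :- x) refl i j) (∣m⇒∣-m d))

  mod-trans : ∀ {i j k} → i ≡ j [mod n ] → j ≡ k [mod n ] → i ≡ k [mod n ]
  mod-trans {i} {j} {k} (mod d) (mod e) = mod (subst (+ n ∣_)
    (solve 3 (λ x y z → (x :- y) :+ (y :- z) := x :- z) refl i j k)
    (∣m∣n⇒∣m+n d e))

  mod-+-cong : ∀ {i j k l} → i ≡ j [mod n ] → k ≡ l [mod n ] →
               (i ℤ.+ k) ≡ (j ℤ.+ l) [mod n ]
  mod-+-cong {i} {j} {k} {l} (mod d) (mod e) = mod (subst (+ n ∣_)
    (solve 4 (λ x y z w → (x :- y) :+ (z :- w) := (x :+ z) :- (y :+ w)) refl i j k l)
    (∣m∣n⇒∣m+n d e))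

  mod-neg-cong : ∀ {i j} → i ≡ j [mod n ] → (- i) ≡ (- j) [mod n ]
  mod-neg-cong {i} {j} (mod d) = mod (subst (+ n ∣_)
    (solve 2 (λ x y → :- (x :- y) := (:- x) :- (:- y)) refl i j) (∣m⇒∣-m d))

  mod-%ℕ : ∀ i .{{_ : NonZero n}} → i ≡ + (i %ℕ n) [mod n ]
  mod-%ℕ i = mod (divides (i /ℕ n)
    (trans (cong (ℤ._- + (i %ℕ n)) (a≡a%ℕn+[a/ℕn]*n i n))
      (solve 2 (λ x y → (x :+ y) :- x := y) refl (+ (i %ℕ n)) ((i /ℕ n) ℤ.* + n))))

  mod-unique-≤ : ∀ {a b} → b ≤ a → a < n → + a ≡ + b [mod n ] → a ≡ b
  mod-unique-≤ {a} {b} b≤a a<n (mod d) = ℕ.≤-antisym (ℕ.m∸n≡0⇒m≤n (lemma n∣a∸b a∸b<n)) b≤a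
    where
    n∣a∸b : n ℕ.∣ a ∸ b
    n∣a∸b = ∣⇒∣ᵤ (subst (+ n ∣_) (trans (ℤ.[+m]-[+n]≡m⊖n a b) (ℤ.⊖-≥ b≤a)) d)

    a∸b<n : a ∸ b < n
    a∸b<n = ℕ.≤-<-trans (ℕ.m∸n≤m a b) a<n

    lemma : ∀ {m} → n ℕ.∣ m → m < n → m ≡ 0
    lemma {zero}  _   _   = refl
    lemma {suc m} n∣m m<n = contradiction n∣m (ℕ.>⇒∤ m<n)

  mod-unique : ∀ {a b} → a < n → b < n → + a ≡ + b [mod n ] → a ≡ b
  mod-unique {a} {b} a<n b<n e with ℕ.≤-total a b
  ... | inj₁ a≤b = sym (mod-unique-≤ a≤b b<n (mod-sym e))
  ... | inj₂ b≤a = mod-unique-≤ b≤a a<n e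

ℤ/_ℤ : (n : ℕ) .{{_ : NonZero n}} → FiniteAbelianGroup 0ℓ 0ℓ
ℤ/ n ℤ = record
  { abelianGroup = record
    { Carrier = ℤ
    ; _≈_     = _≡_[mod n ]
    ; _∙_     = ℤ._+_
    ; ε       = 0ℤ
    ; _⁻¹     = -_
    ; isAbelianGroup = record
      { isGroup = record
        { isMonoid = record
          { isSemigroup = record
            { isMagma = record
              { isEquivalence = record
                { refl  = mod-reflexive refl
                ; sym   = mod-sym
                ; trans = mod-trans
                }
              ; ∙-cong = mod-+-cong
              }
            ; assoc = λ i j k → mod-reflexive (ℤ.+-assoc i j k)
            }
          ; identity = (λ i → mod-reflexive (ℤ.+-identityˡ i))
                     , (λ i → mod-reflexive (ℤ.+-identityʳ i))
          }
        ; inverse = (λ i → mod-reflexive (ℤ.+-inverseˡ i))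
                  , (λ i → mod-reflexive (ℤ.+-inverseʳ i))
        ; ⁻¹-cong = mod-neg-cong
        }
      ; comm = λ i j → mod-reflexive (ℤ.+-comm i j)
      }
    }
  ; order = n
  ; enumeration = record
    { to        = residue
    ; from      = representative
    ; to-cong   = residue-cong
    ; from-cong = λ { refl → mod-reflexive refl }
    ; inverse   = (λ {x} e → trans (residue-cong e) (residue-representative x))
                , (λ { refl → representative-residue _ })
    }
  }
  where
  residue : ℤ → Fin n
  residue i = fromℕ< (n%ℕd<d i n)

  representative : Fin n → ℤ
  representative x = + toℕ x

  representative-residue : ∀ i → representative (residue i) ≡ i [mod n ]
  representative-residue i = mod-trans
    (mod-reflexive (cong +_ (toℕ-fromℕ< (n%ℕd<d i n)))) (mod-sym (mod-%ℕ i))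

  residue-cong : ∀ {i j} → i ≡ j [mod n ] → residue i ≡ residue j
  residue-cong {i} {j} e = toℕ-injective (mod-unique (toℕ<n _) (toℕ<n _)
    (mod-trans (representative-residue i)
      (mod-trans e (mod-sym (representative-residue j)))))

  residue-representative : ∀ x → residue (representative x) ≡ x
  residue-representative x = toℕ-injective (mod-unique (toℕ<n _) (toℕ<n _)
    (representative-residue (representative x)))

-- Upper bound: let e list k + 1 elements of A, with sum σ.  Since k + 1 is
-- invertible, at most one entry b has (k + 1) b = σ.  The elements σ − k b for
-- the other entries b, and the k + 1 entries themselves, are 2k + 1 > p
-- residues, so a = σ − k b for two entries a and b.  Here a ≠ b, and deleting a
-- leaves k elements with sum σ − a = k b.
--
-- Lower bound: k nonzero residues with sum 0 contain no barycentric k-subset,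
-- because k is invertible.  For even k take ±1, …, ±k/2; for odd k take
-- 1, 2, −3, ±4, …, ±(k+3)/2.
module Submission where

open import Defs
open import Algebra.Definitions.RawMonoid using (sum) renaming (_×_ to _·_)
open import Data.Fin.Base as Fin using (Fin; zero; suc; splitAt; punchIn; punchOut; inject≤)
import Data.Fin.Properties as Fin
open import Data.Fin.Subset using (Subset; inside; outside; _∈_; ∣_∣)
open import Data.Integer.Base as ℤ using (ℤ; +_; -[1+_]; 0ℤ)
open import Data.Integer.Divisibility.Signed using (∣⇒∣ᵤ; ∣ᵤ⇒∣)
import Data.Integer.Properties as ℤ
open import Data.Integer.Solver using (module +-*-Solver)
open import Data.Nat
  using (ℕ; zero; suc; _+_; _*_; _∸_; _≤_; _<_; _/_; _%_; z≤n; s≤s; s≤s⁻¹; NonZero; >-nonZero)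
open import Data.Nat.Divisibility using (_∣_; divides; >⇒∤)
open import Data.Nat.DivMod using (m≡m%n+[m/n]*n; m%n<n)
open import Data.Nat.Primality using (Prime; prime⇒nonZero; prime⇒irreducible; euclidsLemma)
import Data.Nat.Properties as ℕ
open import Data.Nat.Solver renaming (module +-*-Solver to NatSolver)
open import Data.Product.Base using (∃; ∃₂; _×_; _,_; proj₁; proj₂; map₂)
open import Data.Sum.Base using (_⊎_; inj₁; inj₂; [_,_]′)
open import Data.Vec.Base using (Vec; []; _∷_; here; there; lookup; tabulate)
open import Data.Vec.Functional using (Vector; removeAt)
open import Data.Vec.Properties using (lookup∘tabulate; []=⇒lookup; lookup⇒[]=)
open import Data.Vec.Relation.Unary.All as All using (All; []; _∷_)
open import Data.Vec.Relation.Unary.All.Properties using (lookup⁺)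
open import Data.Vec.Relation.Unary.AllPairs using ([]; _∷_)
open import Data.Vec.Relation.Unary.Unique.Propositional using (Unique)
open import Data.Vec.Relation.Unary.Unique.Propositional.Properties using (lookup-injective)
open import Function.Base using (_∘_)
open import Function.Bundles using (Inverse)
open import Function.Definitions using (Injective)
open import Level using (Level)
open import Relation.Binary.PropositionalEquality
  using (_≡_; _≢_; refl; sym; trans; cong; cong₂; subst; module ≡-Reasoning)
open import Relation.Nullary.Decidable using (Dec; yes; no; does; map′; dec-true)
open import Relation.Nullary.Negation using (¬_; contradiction)
import Algebra.Properties.CommutativeMonoid.Sum as Sum
import Algebra.Properties.Group as GroupProperties
import Algebra.Properties.Monoid.Mult as Mult
import Relation.Binary.Reasoning.Setoid as ≈-Reasoning

private
  variable
    c ℓ : Level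
    k l m n : ℕ

-- Finite sets

-- Pigeonhole on the concatenation of `f` and `g`: injectivity rules out a collision within either
-- half, so the collision is between the halves.
ranges-meet : {f : Fin l → Fin n} {g : Fin m → Fin n} →
              Injective _≡_ _≡_ f → Injective _≡_ _≡_ g →
              n < l + m → ∃₂ λ i j → f i ≡ g j
ranges-meet {l} {f = f} {g} f-inj g-inj n<l+m
  with i , j , i<j , eq ← Fin.pigeonhole n<l+m ([ f , g ]′ ∘ splitAt l)
  with splitAt l i in i≡ | splitAt l j in j≡
... | inj₁ a | inj₂ b = a , b , eq
... | inj₂ a | inj₁ b = b , a , sym eq
... | inj₁ a | inj₁ b = contradiction (trans (sym (Fin.splitAt⁻¹-↑ˡ i≡))
        (trans (cong (Fin._↑ˡ _) (f-inj eq)) (Fin.splitAt⁻¹-↑ˡ j≡))) (Fin.<⇒≢ i<j)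
... | inj₂ a | inj₂ b = contradiction (trans (sym (Fin.splitAt⁻¹-↑ʳ i≡))
        (trans (cong (l Fin.↑ʳ_) (g-inj eq)) (Fin.splitAt⁻¹-↑ʳ j≡))) (Fin.<⇒≢ i<j)

nth : (A : Subset n) → Fin ∣ A ∣ → Fin n
nth (outside ∷ A) i       = suc (nth A i)
nth (inside  ∷ A) zero    = zero
nth (inside  ∷ A) (suc i) = suc (nth A i)

nth-∈ : (A : Subset n) (i : Fin ∣ A ∣) → nth A i ∈ A
nth-∈ (outside ∷ A) i       = there (nth-∈ A i)
nth-∈ (inside  ∷ A) zero    = here
nth-∈ (inside  ∷ A) (suc i) = there (nth-∈ A i)

nth-injective : (A : Subset n) → Injective _≡_ _≡_ (nth A)
nth-injective (outside ∷ A) eq = nth-injective A (Fin.suc-injective eq)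
nth-injective (inside  ∷ A) {zero}  {zero}  eq = refl
nth-injective (inside  ∷ A) {suc i} {suc j} eq =
  cong suc (nth-injective A (Fin.suc-injective eq))

nth-surjective : (A : Subset n) {x : Fin n} → x ∈ A → ∃ λ i → nth A i ≡ x
nth-surjective (inside  ∷ A) here = zero , refl
nth-surjective (outside ∷ A) (there x∈A) =
  map₂ (cong suc) (nth-surjective A x∈A)
nth-surjective (inside  ∷ A) (there x∈A) with i , eq ← nth-surjective A x∈A =
  suc i , cong suc eq

-- The position of `e i` in the listing `nth A` determines `e i`, so these positions embed `Fin k`
-- into `Fin ∣ A ∣`.
injective⇒≤∣∣ : (A : Subset n) {e : Fin k → Fin n} → Injective _≡_ _≡_ e →
                (∀ i → e i ∈ A) → k ≤ ∣ A ∣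
injective⇒≤∣∣ A {e} e-inj e∈A = Fin.injective⇒≤ {f = proj₁ ∘ position} λ {i} {j} eq →
  e-inj (trans (sym (proj₂ (position i))) (trans (cong (nth A) eq) (proj₂ (position j))))
  where
  position = λ i → nth-surjective A (e∈A i)

module _ (e : Fin k → Fin n) where

  hits? : (x : Fin n) → Dec (∃ λ i → e i ≡ x)
  hits? x = Fin.any? (λ i → e i Fin.≟ x)

  image : Subset n
  image = tabulate (does ∘ hits?)

  ∈-image⁺ : ∀ i → e i ∈ image
  ∈-image⁺ i = lookup⇒[]= (e i) image
    (trans (lookup∘tabulate (does ∘ hits?) (e i)) (dec-true (hits? (e i)) (i , refl)))

  ∈-image⁻ : ∀ {x} → x ∈ image → ∃ λ i → e i ≡ x
  ∈-image⁻ {x} x∈ with hits? x | trans (sym (lookup∘tabulate (does ∘ hits?) x)) ([]=⇒lookup x∈)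
  ... | yes hit | _ = hit
  ... | no _    | ()

-- Finite abelian groups

module _ (G : FiniteAbelianGroup c ℓ) where
  open FiniteAbelianGroup G renaming (sym to ≈-sym; trans to ≈-trans; refl to ≈-refl)
  open Sum commutativeMonoid using (sum-remove)
  open GroupProperties group using (∙-cancelˡ; ⁻¹-injective; //-rightDividesˡ)
  open Mult monoid using (×-congʳ)
  open ≈-Reasoning setoid
  open Inverse enumeration using ()
    renaming (to-cong to index-cong; strictlyInverseˡ to index-element; strictlyInverseʳ to element-index)

  private
    _⋆_ : ℕ → Carrier → Carrier
    _⋆_ = _·_ rawMonoid

    Σ[_] : Vector Carrier n → Carrier
    Σ[_] = sum rawMonoid

    index-injective : Injective _≈_ _≡_ index
    index-injective {x} {y} eq = ≈-trans (≈-sym (element-index x))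
      (≈-trans (reflexive (cong element eq)) (element-index y))

    _≈?_ : ∀ x y → Dec (x ≈ y)
    x ≈? y = map′ index-injective index-cong (index x Fin.≟ index y)

  -- Induction on the common length: delete from `f` the entry matching `g zero`. Since `g` is
  -- injective, its other entries match entries of `f` that survive the deletion.
  relisting⇒sum≈ : (f g : Vector Carrier n) → Injective _≡_ _≈_ g →
                   (∀ i → ∃ λ j → g i ≈ f j) → Σ[ g ] ≈ Σ[ f ]
  relisting⇒sum≈ {zero}  f g g-inj g⊆f = ≈-refl
  relisting⇒sum≈ {suc n} f g g-inj g⊆f with j , g₀≈fj ← g⊆f zero = begin
    g zero ∙ Σ[ g ∘ suc ]     ≈⟨ ∙-cong g₀≈fj (relisting⇒sum≈ (removeAt f j) (g ∘ suc)
                                   (Fin.suc-injective ∘ g-inj) tail⊆) ⟩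
    f j ∙ Σ[ removeAt f j ]   ≈⟨ sum-remove f ⟨
    Σ[ f ]                    ∎
    where
    tail⊆ : ∀ i → ∃ λ l → g (suc i) ≈ removeAt f j l
    tail⊆ i with l , gᵢ≈fl ← g⊆f (suc i) = punchOut j≢l ,
      ≈-trans gᵢ≈fl (reflexive (cong f (sym (Fin.punchIn-punchOut j≢l))))
      where
      j≢l : j ≢ l
      j≢l j≡l = contradiction
        (g-inj (≈-trans g₀≈fj (≈-trans (reflexive (cong f j≡l)) (≈-sym gᵢ≈fl)))) λ()

  -- If `m` ≤ `k`, the image of `e` is large enough to contain a barycentric `k`-subset. Its listing
  -- `g` can only relist `e`, so `e` itself would be barycentric.
  nonBarycentric⇒< : (e : Vector Carrier k) → Injective _≡_ _≈_ e → ¬ IsBarycentric G k e →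
                     ForcesBarycentric G k m → k < m
  nonBarycentric⇒< {k} e e-inj ¬bary forces = ℕ.≰⇒> λ m≤k →
    let g , g-inj , g∈A , i , Σg≈kgᵢ = forces A (ℕ.≤-trans m≤k k≤∣A∣)
        g⊆e = λ i → map₂ (index-injective ∘ sym) (∈-image⁻ (index ∘ e) (g∈A i))
        j , gᵢ≈eⱼ = g⊆e i
    in ¬bary (j , ≈-trans (≈-sym (relisting⇒sum≈ e g g-inj g⊆e))
                          (≈-trans Σg≈kgᵢ (×-congʳ k gᵢ≈eⱼ)))
    where
    A = image (index ∘ e)

    k≤∣A∣ : k ≤ ∣ A ∣
    k≤∣A∣ = injective⇒≤∣∣ A (e-inj ∘ index-injective) (∈-image⁺ (index ∘ e))

  -- Stated with a default exception t so that punchIn t enumerates k entries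
  -- that are not exceptional, whether or not an exception exists.
  at-most-one-exception : (e : Vector Carrier (suc k)) → Injective _≡_ _≈_ e →
    Injective _≈_ _≈_ (suc k ⋆_) → ∀ x → ∃ λ t → ∀ i → suc k ⋆ e i ≈ x → t ≡ i
  at-most-one-exception {k} e e-inj sk-inj x with Fin.any? (λ i → (suc k ⋆ e i) ≈? x)
  ... | yes (t , t≈) = t , λ i i≈ → e-inj (sk-inj (≈-trans t≈ (≈-sym i≈)))
  ... | no ∄         = zero , λ i i≈ → contradiction (i , i≈) ∄

  removal-barycentric : order < k + suc k → Injective _≈_ _≈_ (k ⋆_) →
    Injective _≈_ _≈_ (suc k ⋆_) → (e : Vector Carrier (suc k)) → Injective _≡_ _≈_ e →
    ∃ λ i → IsBarycentric G k (removeAt e i)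
  removal-barycentric {k} order<2k+1 k-inj sk-inj e e-inj = a , punchOut a≢b , (begin
    Σ[ removeAt e a ]                         ≈⟨ ∙-cancelˡ (e a) _ _
                                                   (≈-trans (≈-sym (sum-remove e)) (≈-sym ea+keb≈σ)) ⟩
    k ⋆ e b                                   ≈⟨ ×-congʳ k (reflexive
                                                   (cong e (Fin.punchIn-punchOut a≢b))) ⟨
    k ⋆ removeAt e a (punchOut a≢b)           ∎)
    where
    σ = Σ[ e ]
    t = proj₁ (at-most-one-exception e e-inj sk-inj σ)

    collision : ∃₂ λ i j → index (σ ∙ (k ⋆ e (punchIn t i)) ⁻¹) ≡ index (e j)
    collision = ranges-meet
      -- Multiplication by `k` is injective, hence so is b ↦ σ - k b on the entries.
      (λ eq → Fin.punchIn-injective t _ _ (e-inj (k-inj (⁻¹-injective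
        (∙-cancelˡ σ _ _ (index-injective eq))))))
      (e-inj ∘ index-injective) order<2k+1

    a b : Fin (suc k)
    a = proj₁ (proj₂ collision)
    b = punchIn t (proj₁ collision)

    ea+keb≈σ : e a ∙ k ⋆ e b ≈ σ
    ea+keb≈σ = begin
      e a ∙ k ⋆ e b                       ≈⟨ ∙-congʳ (index-injective (proj₂ (proj₂ collision))) ⟨
      (σ ∙ (k ⋆ e b) ⁻¹) ∙ k ⋆ e b        ≈⟨ //-rightDividesˡ (k ⋆ e b) σ ⟩
      σ                                   ∎

    -- If `a` and `b` coincided, `ea+keb≈σ` would read (k + 1) `e b` = `σ`, making `b` the exception
    -- `t`, which `punchIn t` avoids.
    a≢b : a ≢ b
    a≢b a≡b = Fin.punchInᵢ≢i t (proj₁ collision) (sym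
      (proj₂ (at-most-one-exception e e-inj sk-inj σ) b
        (≈-trans (∙-congʳ (reflexive (cong e (sym a≡b)))) ea+keb≈σ)))

  forcesBarycentric : order < k + suc k → Injective _≈_ _≈_ (k ⋆_) →
                      Injective _≈_ _≈_ (suc k ⋆_) → ForcesBarycentric G k (suc k)
  forcesBarycentric {k} order<2k+1 k-inj sk-inj A sk≤∣A∣ =
    let i , bary = removal-barycentric order<2k+1 k-inj sk-inj e e-inj
    in removeAt e i
     , (λ {x} {y} → Fin.punchIn-injective i x y ∘ e-inj)
     , (λ j → subst (_∈ A) (sym (index-element (e₀ (punchIn i j)))) (e₀∈A (punchIn i j)))
     , bary
    where
    -- `A` may have more than k + 1 elements; only the first k + 1 in the order of `nth A` are kept.
    e₀ : Fin (suc k) → Fin order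
    e₀ i = nth A (inject≤ i sk≤∣A∣)

    e₀∈A : ∀ i → e₀ i ∈ A
    e₀∈A i = nth-∈ A (inject≤ i sk≤∣A∣)

    e : Vector Carrier (suc k)
    e = element ∘ e₀

    e-inj : Injective _≡_ _≈_ e
    e-inj {i} {j} eq = Fin.inject≤-injective sk≤∣A∣ sk≤∣A∣ i j (nth-injective A
      (trans (sym (index-element (e₀ i))) (trans (index-cong eq) (index-element (e₀ j)))))

-- Zero-sum vectors of small nonzero integers

InRange : ℕ → ℤ → Set
InRange r x = 1 ≤ ℤ.∣ x ∣ × ℤ.∣ x ∣ ≤ r

-- Prepends the pairs ±(s + h), ..., ±(s + 1). In the form `h * 2 + m` the length unfolds by two at
-- each step.
_±⟨_⟩_ : Vec ℤ m → (s h : ℕ) → Vec ℤ (h * 2 + m)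
v ±⟨ s ⟩ zero  = v
v ±⟨ s ⟩ suc h = + suc (h + s) ∷ -[1+ h + s ] ∷ v ±⟨ s ⟩ h

module _ {v : Vec ℤ m} (s : ℕ) where

  ±-range : All (InRange s) v → ∀ h → All (InRange (h + s)) (v ±⟨ s ⟩ h)
  ±-range v-range zero    = v-range
  ±-range v-range (suc h) = (s≤s z≤n , ℕ.≤-refl) ∷ (s≤s z≤n , ℕ.≤-refl) ∷
    All.map (map₂ ℕ.m≤n⇒m≤1+n) (±-range v-range h)

  -- The two new entries differ in sign, and their absolute value h + s + 1 exceeds that of every
  -- later entry.
  ±-unique : All (InRange s) v → Unique v → ∀ h → Unique (v ±⟨ s ⟩ h)
  ±-unique v-range v-unique zero    = v-unique
  ±-unique v-range v-unique (suc h) =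
    ((λ ()) ∷ All.map (fresh refl) rest) ∷ All.map (fresh refl) rest ∷ ±-unique v-range v-unique h
    where
    rest = ±-range v-range h

    fresh : ∀ {x y} → ℤ.∣ x ∣ ≡ suc (h + s) → InRange (h + s) y → x ≢ y
    fresh ∣x∣≡ (_ , ∣y∣≤) refl = ℕ.1+n≰n (subst (_≤ h + s) ∣x∣≡ ∣y∣≤)

  ±-sum : ∀ h → sum ℤ.+-0-rawMonoid (lookup (v ±⟨ s ⟩ h)) ≡ sum ℤ.+-0-rawMonoid (lookup v)
  ±-sum zero    = refl
  ±-sum (suc h) = begin
    -- `-[1+ h + s ]` is `ℤ.- r` by computation.
    r ℤ.+ (ℤ.- r ℤ.+ Σ)   ≡⟨ ℤ.+-assoc r (ℤ.- r) Σ ⟨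
    r ℤ.+ ℤ.- r ℤ.+ Σ     ≡⟨ cong (ℤ._+ Σ) (ℤ.+-inverseʳ r) ⟩
    0ℤ ℤ.+ Σ              ≡⟨ ℤ.+-identityˡ Σ ⟩
    Σ                     ≡⟨ ±-sum h ⟩
    sum ℤ.+-0-rawMonoid (lookup v)  ∎
    where
    open ≡-Reasoning
    r = + suc (h + s)
    Σ = sum ℤ.+-0-rawMonoid (lookup (v ±⟨ s ⟩ h))

1,2,-3 : Vec ℤ 3
1,2,-3 = + 1 ∷ + 2 ∷ -[1+ 2 ] ∷ []

1,2,-3-range : All (InRange 3) 1,2,-3
1,2,-3-range = (s≤s z≤n , s≤s z≤n) ∷ (s≤s z≤n , s≤s (s≤s z≤n)) ∷ (s≤s z≤n , ℕ.≤-refl) ∷ []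

1,2,-3-unique : Unique 1,2,-3
1,2,-3-unique = ((λ ()) ∷ (λ ()) ∷ []) ∷ ((λ ()) ∷ []) ∷ [] ∷ []

-- The two forms are the lengths of `h` opposite pairs put before `[]` and before `1,2,-3`.
even⊎odd : ∀ k → 2 ≤ k → (∃ λ h → k ≡ h * 2 + 0) ⊎ (∃ λ h → k ≡ h * 2 + 3)
even⊎odd (suc zero)                  (s≤s ())
even⊎odd (suc (suc zero))            _ = inj₁ (1 , refl)
even⊎odd (suc (suc (suc zero)))      _ = inj₂ (0 , refl)
even⊎odd (suc (suc k@(suc (suc _)))) _ with even⊎odd k (s≤s (s≤s z≤n))
... | inj₁ (h , k≡) = inj₁ (suc h , cong (_+_ 2) k≡)
... | inj₂ (h , k≡) = inj₂ (suc h , cong (_+_ 2) k≡)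

-- Residues modulo a prime

-- By the triangle inequality the difference is a multiple of `n` of absolute value below `n`, hence
-- zero.
small-unique-mod : ∀ {i j} → ℤ.∣ i ∣ + ℤ.∣ j ∣ < n → i ≡ j [mod n ] → i ≡ j
small-unique-mod {n} {i} {j} small (mod n∣i-j) = ℤ.i-j≡0⇒i≡j i j (ℤ.∣i∣≡0⇒i≡0 ∣i-j∣≡0)
  where
  ∣i-j∣≡0 : ℤ.∣ i ℤ.- j ∣ ≡ 0
  ∣i-j∣≡0 with ℤ.∣ i ℤ.- j ∣ | ∣⇒∣ᵤ n∣i-j | ℕ.≤-<-trans (ℤ.∣i-j∣≤∣i∣+∣j∣ i j) small
  ... | zero  | _   | _   = refl
  ... | suc d | n∣d | d<n = contradiction n∣d (>⇒∤ d<n)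

module _ {p : ℕ} (p-prime : Prime p) where
  private
    instance
      p≢0 : NonZero p
      p≢0 = prime⇒nonZero p-prime

    G = ℤ/ p ℤ

  open FiniteAbelianGroup G using (_≈_; rawMonoid) renaming (sym to ≈-sym; trans to ≈-trans)

  ·≡* : ∀ k x → _·_ rawMonoid k x ≡ + k ℤ.* x
  ·≡* zero    x = sym (ℤ.*-zeroˡ x)
  ·≡* (suc k) x = trans (cong (λ y → x ℤ.+ y) (·≡* k x)) (sym (ℤ.suc-* (+ k) x))

  -- The two raw monoids have the same operations but different equalities, so
  -- this does not hold definitionally.
  sum≡sum : (e : Vector ℤ k) → sum rawMonoid e ≡ sum ℤ.+-0-rawMonoid e
  sum≡sum {zero}  e = refl
  sum≡sum {suc k} e = cong (λ y → e zero ℤ.+ y) (sum≡sum (e ∘ suc))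

  -- Euclid's lemma applied to p dividing k (x - y): as 0 < k < p, the factor divisible by p is x -
  -- y.
  ·-injective : 1 ≤ k → k < p → Injective _≈_ _≈_ (_·_ rawMonoid k)
  ·-injective {k} k>0 k<p {x} {y} (mod p∣kx-ky) =
    [ (λ p∣k → contradiction p∣k (>⇒∤ {{>-nonZero k>0}} k<p)) , (λ p∣x-y → mod (∣ᵤ⇒∣ p∣x-y)) ]′
    (euclidsLemma k ℤ.∣ x ℤ.- y ∣ p-prime
      (subst (p ∣_) (trans (cong ℤ.∣_∣ factor) (ℤ.abs-* (+ k) (x ℤ.- y))) (∣⇒∣ᵤ p∣kx-ky)))
    where
    open +-*-Solver
    factor : _·_ rawMonoid k x ℤ.- _·_ rawMonoid k y ≡ + k ℤ.* (x ℤ.- y)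
    factor = trans (cong₂ ℤ._-_ (·≡* k x) (·≡* k y))
      (solve 3 (λ k x y → k :* x :- k :* y := k :* (x :- y)) refl (+ k) x y)

  -- A barycentric entry would satisfy k `e j` = 0 = k 0 modulo p, and cancelling k would make it
  -- zero.
  nonzero-zeroSum⇒nonBarycentric : 1 ≤ k → k < p → (e : Vector ℤ k) → sum ℤ.+-0-rawMonoid e ≡ 0ℤ →
    (∀ i → ¬ e i ≈ 0ℤ) → ¬ IsBarycentric G k e
  nonzero-zeroSum⇒nonBarycentric {k} k>0 k<p e Σe≡0 e≉0 (j , Σe≈keⱼ) =
    e≉0 j (·-injective k>0 k<p (≈-trans (≈-sym Σe≈keⱼ)
      (mod-reflexive (trans (trans (sum≡sum e) Σe≡0) (sym (trans (·≡* k 0ℤ) (ℤ.*-zeroʳ (+ k))))))))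

  -- Since 2r < p, integers of absolute value at most r are congruent only if equal. Thus distinct
  -- nonzero entries stay distinct and nonzero modulo p.
  zeroSum⇒< : 1 ≤ k → k < p → ∀ {r} (v : Vec ℤ k) → All (InRange r) v → Unique v →
    sum ℤ.+-0-rawMonoid (lookup v) ≡ 0ℤ → r + r < p → ForcesBarycentric G k m → k < m
  zeroSum⇒< k>0 k<p {r} v v-range v-unique Σv≡0 2r<p =
    nonBarycentric⇒< G (lookup v) v-injective
      (nonzero-zeroSum⇒nonBarycentric k>0 k<p (lookup v) Σv≡0 v≉0)
    where
    v-injective : Injective _≡_ _≈_ (lookup v)
    v-injective {i} {j} vᵢ≈vⱼ = lookup-injective v-unique i j (small-unique-mod
      (ℕ.≤-<-trans (ℕ.+-mono-≤ (proj₂ (lookup⁺ v-range i)) (proj₂ (lookup⁺ v-range j))) 2r<p)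
      vᵢ≈vⱼ)

    v≉0 : ∀ i → ¬ lookup v i ≈ 0ℤ
    v≉0 i vᵢ≈0 with 1≤∣vᵢ∣ , ∣vᵢ∣≤r ← lookup⁺ v-range i =
      ℕ.<⇒≢ 1≤∣vᵢ∣ (cong ℤ.∣_∣ (sym (small-unique-mod
        (ℕ.≤-<-trans (ℕ.+-mono-≤ ∣vᵢ∣≤r z≤n) 2r<p) vᵢ≈0)))

  2∤p : 7 ≤ p → ∀ h → p ≢ h * 2
  2∤p p≥7 h p≡2h with prime⇒irreducible p-prime (divides h p≡2h)
  ... | inj₁ ()
  ... | inj₂ refl = contradiction p≥7 λ { (s≤s (s≤s ())) }

  forces⇒< : 7 ≤ p → 2 ≤ k → k + 3 ≤ p → ForcesBarycentric G k m → k < m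
  forces⇒< p≥7 k≥2 k+3≤p with even⊎odd _ k≥2
  ... | inj₁ (h , refl) = zeroSum⇒< (ℕ.<⇒≤ k≥2) (ℕ.<-≤-trans (ℕ.m<m+n _ (s≤s z≤n)) k+3≤p)
    ([] ±⟨ 0 ⟩ h) (±-range 0 [] h) (±-unique 0 [] [] h) (±-sum {v = []} 0 h)
    -- The largest absolute value is r = h, so 2r = k < p.
    (subst (_< p) (solve 1 (λ h → h :* con 2 :+ con 0 := (h :+ con 0) :+ (h :+ con 0)) refl h)
      (ℕ.<-≤-trans (ℕ.m<m+n (h * 2 + 0) {3} (s≤s z≤n)) k+3≤p))
    where open NatSolver
  ... | inj₂ (h , refl) = zeroSum⇒< (ℕ.<⇒≤ k≥2) (ℕ.<-≤-trans (ℕ.m<m+n _ (s≤s z≤n)) k+3≤p)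
    (1,2,-3 ±⟨ 3 ⟩ h) (±-range 3 1,2,-3-range h) (±-unique 3 1,2,-3-range 1,2,-3-unique h)
    (±-sum {v = 1,2,-3} 3 h)
    (subst (_< p) (solve 1 (λ h → h :* con 2 :+ con 3 :+ con 3 := (h :+ con 3) :+ (h :+ con 3)) refl h)
      -- Here r = h + 3, so 2r = k + 3, where the hypothesis only gives k + 3 ≤ p. Equality fails by
      -- parity: k + 3 is even and p is odd.
      (ℕ.≤∧≢⇒< k+3≤p λ k+3≡p → 2∤p p≥7 (3 + h) (trans (sym k+3≡p)
        (solve 1 (λ h → h :* con 2 :+ con 3 :+ con 3 := (con 3 :+ h) :* con 2) refl h))))
    where open NatSolver

n/2≤k⇒n≤1+2k : ∀ n k → n / 2 ≤ k → n ≤ suc (k + k)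
n/2≤k⇒n≤1+2k n k n/2≤k = begin
  n                    ≡⟨ m≡m%n+[m/n]*n n 2 ⟩
  n % 2 + n / 2 * 2    ≤⟨ ℕ.+-mono-≤ (ℕ.<⇒≤pred (m%n<n n 2)) (ℕ.*-monoˡ-≤ 2 n/2≤k) ⟩
  1 + k * 2            ≡⟨ cong suc (trans (ℕ.*-comm k 2) (cong (_+_ k) (ℕ.+-identityʳ k))) ⟩
  suc (k + k)          ∎
  where open ℕ.≤-Reasoning

mainTheorem6 : (p : ℕ) (p-prime : Prime p) → 7 ≤ p →
    (k : ℕ) → (p + 1) / 2 ≤ k → k ≤ p ∸ 3 →
    BO[ k , (ℤ/ p ℤ) {{prime⇒nonZero p-prime}} ]≡ (k + 1)
mainTheorem6 p p-prime p≥7 k p+1/2≤k k≤p∸3 = subst (BO[ k , G ]≡_) (ℕ.+-comm 1 k)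
  ( forcesBarycentric G (subst (p <_) (sym (ℕ.+-suc k k)) (s≤s p≤2k))
      (·-injective p-prime k≥1 (ℕ.<-trans (ℕ.n<1+n k) 1+k<p)) (·-injective p-prime (s≤s z≤n) 1+k<p)
  , λ m → forces⇒< p-prime p≥7 k≥2 k+3≤p )
  where
  G = (ℤ/ p ℤ) {{prime⇒nonZero p-prime}}

  p≤2k : p ≤ k + k
  -- Rounding down in `(p + 1) / 2` loses at most one, so p + 1 ≤ 2k + 1.
  p≤2k = s≤s⁻¹ (subst (_≤ suc (k + k)) (ℕ.+-comm p 1) (n/2≤k⇒n≤1+2k (p + 1) k p+1/2≤k))

  k≥2 : 2 ≤ k
  k≥2 = ℕ.≮⇒≥ λ { (s≤s k≤1) →
    contradiction (ℕ.≤-trans p≥7 (ℕ.≤-trans p≤2k (ℕ.+-mono-≤ k≤1 k≤1))) λ { (s≤s (s≤s ())) } }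

  k≥1 : 1 ≤ k
  k≥1 = ℕ.<⇒≤ k≥2

  k+3≤p : k + 3 ≤ p
  k+3≤p = subst (k + 3 ≤_) (ℕ.m∸n+n≡m (ℕ.≤-trans (s≤s (s≤s (s≤s z≤n))) p≥7)) (ℕ.+-monoˡ-≤ 3 k≤p∸3)

  1+k<p : suc k < p
  1+k<p = ℕ.<-≤-trans (subst (suc k <_) (ℕ.+-comm 3 k) (ℕ.m≤n+m (2 + k) 1)) k+3≤p
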